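{- Let $(X,E)$ be an undirected simple graph with finite vertex set $X$, let $Y$ be a finite set and let $F:X\to 2^Y$ be a set-valued mapping with $G(F)\ne\emptyset$. For any execution of Calculation Method 1 applied to $F$, with largest occurring index $i^{max}_1$, the following statements are equivalent: (i) $F$ admits a disparate selection. (ii) Calculation Method 1 does not stop at Step 5. (iii) Calculation Method 1 stops at Step 3. (iv) $F^{i^{max}_1}$ is disparate. (v) $G(F^{i^{max}_1})\ne\emptyset$ and $F^*=F^{i^{max}_1}$.
   Context: Setting. $(X,E)$ is an undirected simple graph with finite vertex set $X$, $Y$ is a finite set, $F:X\to 2^Y$ is a set-valued mapping (empty images are allowed). $\sharp$ denotes cardinality; $\subset$ allows equality. $G(F)=\{(x,y)\in X\times Y\mid y\in F(x)\}$ is the graph of $F$; $F_{|W}$ is the restriction of $F$ to $W\subset X$. A submapping of $F$ is a set-valued mapping $F'$ on the same domain with $G(F')\subset G(F)$. A selection of $F$ is a map $s:X\to Y$ with $s(x)\in F(x)$ for all $x\in X$. Disparate. Points $(x,y),(x',y')\in X\times Y$ are disparate if $(x,y)\ne(x',y')$ and ($y=y'$ implies $\{x,x'\}\notin E$). A set $A\subset X\times Y$ is disparate if any two distinct points of $A$ are disparate. A selection $s$ is disparate if $G(s)=\{(x,s(x))\mid x\in X\}$ is a disparate set. For $A\subset X\times Y$: $hull(A)=\{a\in X\times Y\mid$ there is $a'\in A$ such that $a,a'$ are not disparate$\}$ and $compl(A)=\{a\in X\times Y\mid a,a'$ are disparate for every $a'\in A\}$. Complement mapping. For $W\subset X$ and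 $Z\subset W\times Y$, $F_{W,Z}:X\setminus W\to 2^Y$ is defined by $G(F_{W,Z})=G(F_{|X\setminus W})\cap compl(Z)$. Convention. For a mapping defined on a subset $X'\subset X$, all notions are understood with $X'$ and the subgraph of $(X,E)$ induced by $X'$ in place of $X$ and $(X,E)$. Collections. A collection of $F$ is a family $\mathcal H=(A_V)$ indexed by the nonempty sets $V\subset X$, with $A_V\subset G(F_{|V})$. It is a Hall collection if every $A_V$ is disparate and $\sharp A_V\ge\sharp V$. For $W\subset X$, $\mathcal H_{|W}$ is the family of the $A_V$ with $\emptyset\ne V\subset W$ (a collection of $F_{|W}$), and $\mathcal H_W$ is the family, indexed by the nonempty $V\subset X\setminus W$, of the sets $A_{W\cup V}\cap compl(\bigcup_{A\in\mathcal H_{|W}}A)\cap(V\times Y)$ (a collection of $F_{|X\setminus W}$). For nonempty $W$, $F^{\mathcal H_W}$ is the submapping of $F_{|W}$ with graph $G(F_{|W})\cap compl(\bigcup_{A\in\mathcal H_W}A)$. For nonempty $W$, $\mathcal H$ is $W$-distributed if for every nonempty $V\subset X\setminus W$, $$\sharp\Bigl(A_{W\cup V}\cap\bigl((W\times Y)\cup(hull(\textstyle\bigcup_{A\in\mathcal H_{|W}}A)\cap(V\times Y))\bigr)\Bigr)\le\sharp W .$$ Cascades. For a tuple $(W_1,\dots,W_k)$, $k\ge1$, of subsets of $W_0=X$ put $W_0^c=W_0$ and, for $i=1,\dots,k$, $W_i^c=W_{i-1}\setminus W_i$ if $W_i\subset W_{i-1}$, and $W_i^c=W_{i-1}^c\setminus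 W_i$ otherwise. The tuple is a cascade in $X$ if $W_i\subset W_{i-1}$ or $W_i\subset W_{i-1}^c$ for $i=1,\dots,k$. Put $pre(i)=W_{i-1}$ if $W_i\subset W_{i-1}$ and $pre(i)=W_{i-1}^c$ if $W_i\subset W_{i-1}^c$. Given a collection $\mathcal H$ of $F$ and a cascade, put $\mathcal H(W_1,\dots,W_0)=\mathcal H$, $F(W_1,\dots,W_0)=F$ and inductively for $i=1,\dots,k-1$, writing $\mathcal H'=\mathcal H(W_1,\dots,W_{i-1})$, $F'=F(W_1,\dots,W_{i-1})$ and $\tilde F=F'^{\,\mathcal H'_{W_i}}$: if $W_{i+1}\subset W_i$, then $\mathcal H(W_1,\dots,W_i)=\mathcal H'_{|W_i}$ and $F(W_1,\dots,W_i)=\tilde F$; if $W_{i+1}\subset W_i^c$, then $\mathcal H(W_1,\dots,W_i)=\mathcal H'_{W_i}$ and $F(W_1,\dots,W_i)=F'_{W_i,G(\tilde F)}$. Here $F(W_1,\dots,W_{i-1})$ is a mapping on $pre(i)$ and $\mathcal H(W_1,\dots,W_{i-1})$ is a collection of it. Generalized Hall condition (recursion on $\sharp X\ge 1$). If $\sharp X=1$, $F$ satisfies it if $G(F)\ne\emptyset$. Let $\sharp X>1$ and suppose the condition is defined for mappings on smaller vertex sets. - A nonempty $W\subset X$ is a generalized critical set of $F$ if there is $(x,y)\in(X\setminus W)\times Y$ such that $(F_{\{x\},\{(x,y)\}})_{|W}$ does not satisfy the generalized Hall condition. It is minimal if no proper subset of $W$ is a generalized critical set of $F$. - For a Hall collection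 $\mathcal H$ of $F$, a cascade $(W_1,\dots,W_k)$ in $X$ is a primitive $(F,\mathcal H)$-critical cascade if $W_i$ is a minimal generalized critical set of $F(W_1,\dots,W_{i-1})$ for $i=1,\dots,k$. - A Hall collection $\mathcal H$ of $F$ is distributed if for each primitive $(F,\mathcal H)$-critical cascade $(W_1,\dots,W_k)$ in $X$ the collection $\mathcal H(W_1,\dots,W_{i-1})$ of $F(W_1,\dots,W_{i-1})$ is $W_i$-distributed for $i=1,\dots,k$. - $F$ satisfies the generalized Hall condition if $F$ admits a distributed Hall collection. Disparate kernel. $F^*$ is the submapping of $F$ with $F^*(x)=\{y\in F(x)\mid$ there is a disparate selection $s$ of $F$ with $s(x)=y\}$. $F$ is called disparate if $G(F)\ne\emptyset$ and $F^*=F$. Elimination. For nonempty $W\subset X$, $elim_F(W)$ is the set of all $(x,y)\in G(F_{|X\setminus W})$ such that $(F_{\{x\},\{(x,y)\}})_{|W}$ does not satisfy the generalized Hall condition. A nonempty $W\subset X$ is an elimination set of $F$ if $elim_F(W)\ne\emptyset$. Calculation Method 1. Step 1: set $F^1=F$ and $i=1$. Step 2: choose an elimination set $W\subset X$ of $F^i$. Step 3: if $F^i$ does not admit an elimination set, STOP; otherwise continue. Step 4: define $F^{i+1}$ by $G(F^{i+1})=G(F^i)\setminus elim_{F^i}(W)$. Step 5: if $F^{i+1}(x)=\emptyset$ for some $x\in X$, STOP; otherwise continue. Step 6: increase $i$ to $i+1$ and continue with Step 2. The choices in Step 2 are arbitrary. The method always terminates after finitely many steps; $i^{max}_1$ denotes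 the largest index of a mapping $F^{j}$ occurring: $i^{max}_1$ is the current value of $i$ if the method stops at Step 3, and the current value of $i+1$ if it stops at Step 5. -}

module Defs where

open import Level using (0ℓ)
open import Data.Bool using (if_then_else_)
open import Data.Empty using (⊥)
open import Data.Unit using () renaming (⊤ to Unit)
open import Data.Nat as ℕ using (ℕ; zero; suc; _<_; _≤_; _≥_)
open import Data.Fin using (Fin; combine; remQuot)
open import Data.Fin.Properties using (any?; all?) renaming (_≟_ to _≟ᶠ_)
open import Data.Fin.Subset hiding (⊥)
open import Data.Fin.Subset.Properties
  using (_∈?_; _⊆?_; nonempty?; anySubset?; p∩q⊆p; p∩q⊆q)
open import Data.List using (List; []; _∷_)
open import Data.List.Relation.Unary.All using (All)
open import Data.Product using (∃-syntax; _×_; _,_)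
open import Data.Product.Properties using (≡-dec)
open import Data.Sum using (_⊎_)
open import Data.Vec using (tabulate)
open import Function using (_∘_)
open import Relation.Binary using (Rel; Decidable; Symmetric; Irreflexive)
open import Relation.Binary.PropositionalEquality using (_≡_; _≢_)
open import Relation.Nullary using (¬_; Dec; does)
open import Relation.Nullary.Decidable using (¬?; _×-dec_; _→-dec_)
open import Relation.Unary as U using (Pred; _≐_; _∖_)

record SimpleGraph (n : ℕ) : Set₁ where
  field
    Edge   : Rel (Fin n) 0ℓ
    edge?  : Decidable Edge
    sym    : Symmetric Edge
    irrefl : Irreflexive _≡_ Edge

-- X = Fin n and Y = Fin m.  In Data.Fin.Subset, _⊂_ is proper inclusion and
-- ⊤ is the full set; the operation _─_ is set difference.
module HallTheory {n : ℕ} (Γ : SimpleGraph n) (m : ℕ) where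

  open SimpleGraph Γ using (Edge; edge?)

  Point : Set
  Point = Fin n × Fin m

  -- X × Y is coded as Fin (n * m), so that ∣_∣, _∩_, _∪_, _⊆_ and Nonempty
  -- are those of Data.Fin.Subset.
  PointSet : Set
  PointSet = Subset (n ℕ.* m)

  infix 4 _∈ᴾ_ _∈ᴾ?_

  _∈ᴾ_ : Point → PointSet → Set
  (x , y) ∈ᴾ A = combine x y ∈ A

  _∈ᴾ?_ : ∀ a A → Dec (a ∈ᴾ A)
  (x , y) ∈ᴾ? A = combine x y ∈? A

  ⟦_⟧ : PointSet → Pred Point 0ℓ
  ⟦ A ⟧ a = a ∈ᴾ A

  comprehension : {P : Pred Point 0ℓ} → U.Decidable P → PointSet
  comprehension P? = tabulate (does ∘ P? ∘ remQuot m)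

  singleton : Point → PointSet
  singleton (x , y) = ⁅ combine x y ⁆

  infix 10 _×Y

  _×Y : Subset n → PointSet
  V ×Y = comprehension λ { (x , _) → x ∈? V }

  somePoint? : {P : Pred Point 0ℓ} → U.Decidable P →
               Dec (∃[ x ] ∃[ y ] P (x , y))
  somePoint? P? = any? λ x → any? λ y → P? (x , y)

  everyPoint? : {P : Pred Point 0ℓ} → U.Decidable P →
                Dec (∀ x y → P (x , y))
  everyPoint? P? = all? λ x → all? λ y → P? (x , y)

  -- Only the vertices x, x' of the two points matter, so the relation for an
  -- induced subgraph is the restriction of this one.
  Disparate : Rel Point 0ℓ
  Disparate (x , y) (x′ , y′) =
    (x , y) ≢ (x′ , y′) × (y ≡ y′ → ¬ Edge x x′)

  disparate? : Decidable Disparate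
  disparate? (x , y) (x′ , y′) =
    ¬? (≡-dec _≟ᶠ_ _≟ᶠ_ (x , y) (x′ , y′)) ×-dec
    ((y ≟ᶠ y′) →-dec ¬? (edge? x x′))

  DisparateSet : PointSet → Set
  DisparateSet A = ∀ a b → a ∈ᴾ A → b ∈ᴾ A → a ≢ b → Disparate a b

  -- hull and compl are taken in X × Y also for mappings on D ⊆ X; below they
  -- are always intersected with a subset of D × Y.
  hull : PointSet → PointSet
  hull A = comprehension λ a →
    somePoint? λ a′ → (a′ ∈ᴾ? A) ×-dec ¬? (disparate? a a′)

  compl : PointSet → PointSet
  compl A = comprehension λ a →
    everyPoint? λ a′ → (a′ ∈ᴾ? A) →-dec disparate? a a′

  -- A mapping is given by its graph: y ∈ F(x) means (x , y) ∈ᴾ graph F.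
  record Mapping (D : Subset n) : Set where
    constructor mapping
    field
      graph   : PointSet
      graph⊆ : graph ⊆ D ×Y

  open Mapping public

  infixl 9 _↾_

  _↾_ : ∀ {D} → Mapping D → (W : Subset n) → Mapping W
  F ↾ W = mapping (graph F ∩ W ×Y) (p∩q⊆q (graph F) (W ×Y))

  _∩ᴹ_ : ∀ {D} → Mapping D → PointSet → Mapping D
  F ∩ᴹ A = mapping (graph F ∩ A) (graph⊆ F ∘ p∩q⊆p (graph F) A)

  -- F_{W,Z}
  complementMapping : ∀ {D} → Mapping D → (W : Subset n) → PointSet →
                      Mapping (D ─ W)
  complementMapping {D} F W Z = (F ↾ (D ─ W)) ∩ᴹ compl Z

  -- F_{ {x} , {(x,y)} } restricted to W
  remove↾ : ∀ {D} → Mapping D → Point → (W : Subset n) → Mapping W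
  remove↾ F (x , y) W = complementMapping F ⁅ x ⁆ (singleton (x , y)) ↾ W

  -- A collection of a mapping on D is a family indexed by the nonempty V ⊆ D;
  -- values at other V are never used.  In particular the restriction of a
  -- collection to W is the same function, regarded as a family over W.
  Collection : Set
  Collection = Subset n → PointSet

  IsCollection : ∀ {D} → Mapping D → Collection → Set
  IsCollection {D} F H =
    ∀ V → Nonempty V → V ⊆ D → H V ⊆ graph (F ↾ V)

  IsHallCollection : ∀ {D} → Mapping D → Collection → Set
  IsHallCollection {D} F H =
    IsCollection F H ×
    (∀ V → Nonempty V → V ⊆ D → DisparateSet (H V) × ∣ H V ∣ ≥ ∣ V ∣)

  -- Union of the members of a collection of a mapping on D.
  ⋃[_] : Subset n → Collection → PointSet
  ⋃[ D ] H = comprehension λ a →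
    anySubset? λ V → nonempty? V ×-dec (V ⊆? D) ×-dec (a ∈ᴾ? H V)

  -- 𝓗_W, a family over D ─ W if H is one over D.
  residual : Collection → Subset n → Collection
  residual H W V = (H (W ∪ V) ∩ compl (⋃[ W ] H)) ∩ V ×Y

  -- F^{𝓗_W}
  inner : ∀ {D} → Mapping D → Collection → (W : Subset n) → Mapping W
  inner {D} F H W = (F ↾ W) ∩ᴹ compl (⋃[ D ─ W ] (residual H W))

  -- H, a collection of a mapping on D, is W-distributed.
  WDistributed : Subset n → Collection → Subset n → Set
  WDistributed D H W =
    ∀ V → Nonempty V → V ⊆ D ─ W →
    ∣ H (W ∪ V) ∩ (W ×Y ∪ (hull (⋃[ W ] H) ∩ V ×Y)) ∣ ≤ ∣ W ∣

  -- CascadeFrom P Pᶜ (W_i , … , W_k), where P = W_{i-1} and Pᶜ = W_{i-1}^c.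
  CascadeFrom : Subset n → Subset n → List (Subset n) → Set
  CascadeFrom P Pᶜ []       = Unit
  CascadeFrom P Pᶜ (W ∷ Ws) =
    (W ⊆ P ⊎ W ⊆ Pᶜ) ×
    CascadeFrom W (if does (W ⊆? P) then P ─ W else Pᶜ ─ W) Ws

  IsCascade : Subset n → List (Subset n) → Set
  IsCascade D = CascadeFrom D D

  -- One index i of a cascade: F(W₁,…,W_{i-1}), whose domain is pre(i),
  -- together with 𝓗(W₁,…,W_{i-1}) and W_i.
  record Stage : Set where
    constructor stage
    field
      {pre} : Subset n
      map   : Mapping pre
      coll  : Collection
      set   : Subset n

  -- The stages i = 1,…,k.  For a cascade, W_{i+1} ⊈ W_i leaves only
  -- W_{i+1} ⊆ W_i^c, which is D ─ W_i for D = pre(i).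
  stages : ∀ {D} → Mapping D → Collection → List (Subset n) → List Stage
  stages F H []            = []
  stages F H (W ∷ [])      = stage F H W ∷ []
  stages F H (W ∷ W′ ∷ Ws) = stage F H W ∷
    (if does (W′ ⊆? W)
     then stages (inner F H W) H (W′ ∷ Ws)
     else stages (complementMapping F W (graph (inner F H W)))
                 (residual H W) (W′ ∷ Ws))

  -- The recursive step: P is the generalized Hall condition for mappings on
  -- smaller vertex sets.
  module Step (P : ∀ {D} → Mapping D → Set) where

    Critical : ∀ {D} → Mapping D → Subset n → Set
    Critical {D} F W =
      Nonempty W × W ⊆ D ×
      ∃[ x ] ∃[ y ] (x ∈ D ─ W × ¬ P (remove↾ F (x , y) W))

    MinimalCritical : ∀ {D} → Mapping D → Subset n → Set
    MinimalCritical F W = Critical F W × (∀ W′ → W′ ⊂ W → ¬ Critical F W′)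

    -- The tuple (W₁ , … , W_k) is W ∷ Ws.
    PrimitiveCritical : ∀ {D} → Mapping D → Collection →
                        Subset n → List (Subset n) → Set
    PrimitiveCritical {D} F H W Ws =
      IsCascade D (W ∷ Ws) ×
      All (λ s → MinimalCritical (Stage.map s) (Stage.set s))
          (stages F H (W ∷ Ws))

    Distributed : ∀ {D} → Mapping D → Collection → Set
    Distributed F H =
      ∀ W Ws → PrimitiveCritical F H W Ws →
      All (λ s → WDistributed (Stage.pre s) (Stage.coll s) (Stage.set s))
          (stages F H (W ∷ Ws))

  -- The condition for mappings on at most k vertices.  Every critical set is
  -- a proper subset of the vertex set on which it is critical, hence has at
  -- most k vertices if that set has at most suc k: the bound is never
  -- exhausted.  The condition is not meant for mappings on the empty set.
  GeneralizedHall≤ : ℕ → ∀ {D} → Mapping D → Set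
  GeneralizedHall≤ zero        F = ⊥
  GeneralizedHall≤ (suc k) {D} F =
    (∣ D ∣ ≡ 1 × Nonempty (graph F)) ⊎
    (1 < ∣ D ∣ × ∃[ H ] (IsHallCollection F H × Distributed F H))
    where open Step (GeneralizedHall≤ k)

  GeneralizedHall : ∀ {D} → Mapping D → Set
  GeneralizedHall {D} = GeneralizedHall≤ ∣ D ∣

  selectionGraph : (Fin n → Fin m) → PointSet
  selectionGraph s = comprehension λ { (x , y) → y ≟ᶠ s x }

  IsSelection : Mapping ⊤ → (Fin n → Fin m) → Set
  IsSelection F s = ∀ x → (x , s x) ∈ᴾ graph F

  IsDisparateSelection : Mapping ⊤ → (Fin n → Fin m) → Set
  IsDisparateSelection F s =
    IsSelection F s × DisparateSet (selectionGraph s)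

  AdmitsDisparateSelection : Mapping ⊤ → Set
  AdmitsDisparateSelection F = ∃[ s ] IsDisparateSelection F s

  -- The graph of F*.
  kernel : Mapping ⊤ → Pred Point 0ℓ
  kernel F (x , y) =
    (x , y) ∈ᴾ graph F × ∃[ s ] (IsDisparateSelection F s × s x ≡ y)

  DisparateMapping : Mapping ⊤ → Set
  DisparateMapping F = Nonempty (graph F) × kernel F ≐ ⟦ graph F ⟧

  elim : Mapping ⊤ → Subset n → Pred Point 0ℓ
  elim F W a =
    a ∈ᴾ graph (F ↾ (⊤ ─ W)) × ¬ GeneralizedHall (remove↾ F a W)

  EliminationSet : Mapping ⊤ → Subset n → Set
  EliminationSet F W = Nonempty W × ∃[ a ] elim F W a

  HasEmptyImage : Mapping ⊤ → Set
  HasEmptyImage F = ∃[ x ] ∀ y → ¬ ((x , y) ∈ᴾ graph F)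

  -- G(F′) = G(F) \ elim_F(W)
  Eliminates : Mapping ⊤ → Subset n → Mapping ⊤ → Set
  Eliminates F W F′ = ⟦ graph F′ ⟧ ≐ ⟦ graph F ⟧ ∖ elim F W

  -- Complete executions of the method from the current mapping F = F^i on;
  -- F′ is F^{i+1}.
  data Execution (F : Mapping ⊤) : Set where
    stop₃    : (∀ W → ¬ EliminationSet F W) → Execution F
    stop₅    : ∀ W F′ → EliminationSet F W → Eliminates F W F′ →
               HasEmptyImage F′ → Execution F
    continue : ∀ W F′ → EliminationSet F W → Eliminates F W F′ →
               ¬ HasEmptyImage F′ → Execution F′ → Execution F

  StopsAtStep3 : ∀ {F} → Execution F → Set
  StopsAtStep3 (stop₃ _)                = Unit
  StopsAtStep3 (stop₅ _ _ _ _ _)        = ⊥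
  StopsAtStep3 (continue _ _ _ _ _ run) = StopsAtStep3 run

  StopsAtStep5 : ∀ {F} → Execution F → Set
  StopsAtStep5 (stop₃ _)                = ⊥
  StopsAtStep5 (stop₅ _ _ _ _ _)        = Unit
  StopsAtStep5 (continue _ _ _ _ _ run) = StopsAtStep5 run

  -- The mapping of largest index that occurs.
  final : ∀ {F} → Execution F → Mapping ⊤
  final {F} (stop₃ _)               = F
  final (stop₅ _ F′ _ _ _)          = F′
  final (continue _ _ _ _ _ run)    = final run

{-# OPTIONS --safe #-}
module Submission where

-- Everything rests on one equivalence: a mapping F on a nonempty vertex set D
-- satisfies the generalized Hall condition if and only if it has a disparate
-- selection (generalizedHall⇒selectable, selectable⇒generalizedHall).
--
-- From a disparate selection s, the sets A_V = G(s|V) form a Hall collection.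
-- Passing to residual collections preserves this form, and A_V lies over W
-- wherever it lies in W × Y or in hull(G(s|W)), because s is disparate.  So
-- each stage of a cascade of nonempty sets is distributed, critical or not.
--
-- Conversely, let 𝓗 be a distributed Hall collection of F; argue by induction
-- on D.  If F has no critical set, any point (x , y) of A_D extends to a
-- selection: D ─ {x} is empty or not critical, so that F with the conflicts
-- of (x , y) removed has a selection on D ─ {x} by the induction hypothesis
-- of the recursive definition.  Otherwise let W be a minimal critical set.
-- As 𝓗 is W-distributed, at most |W| points of A_{W ∪ V} are lost in the
-- residual, which is therefore again a Hall collection, on D ─ W.  Both
-- F^{𝓗_W} on W, with 𝓗|W, and F_{W,G(F^{𝓗_W})} on D ─ W, with 𝓗_W, are
-- mappings with Hall collections that are distributed, since a primitive
-- critical cascade of either becomes one of F when W is put in front of it.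
-- Their selections exist by induction and are disparate from each other, so
-- they glue to a selection of F.
--
-- Given the equivalence, one elimination step removes no point through which
-- a disparate selection passes, so the disparate kernel is constant along an
-- execution (kernel-final).  A mapping without elimination sets has through
-- each of its points a selection, by extension from X ─ {x}; a mapping with
-- an empty image has no selection at all.  Hence stopping at Step 3 means
-- that the final mapping is its own kernel, and stopping at Step 5 means that
-- F has no disparate selection.

open import Defs
open import Level using (0ℓ)
open import Data.Fin using (Fin; zero; suc; combine; remQuot; _≟_)
open import Data.Fin.Properties
  using (any?; all?; remQuot-combine; combine-remQuot; combine-injective;
         combine-surjective; suc-injective)
open import Data.Fin.Subset
  using (Subset; inside; outside; _∈_; _∉_; _⊆_; _⊂_; _∩_; _∪_; _─_; _-_; ∣_∣;
         ⁅_⁆; ⊤; Nonempty; Empty)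
  renaming (⊥ to ∅)
open import Data.Fin.Subset.Induction using (Acc; acc; ⊂-wellFounded)
open import Data.Fin.Subset.Properties
  using (_∈?_; _⊆?_; _⊂?_; nonempty?; anySubset?; Empty-unique; ∣⊥∣≡0; ∣⁅x⁆∣≡1;
         ∉⊥; ∈⊤; x∈⁅x⁆; x∈⁅y⁆⇒x≡y; p⊆q⇒∣p∣≤∣q∣; x∈p⇒∣p-x∣<∣p∣;
         x∈p∧x≢y⇒x∈p-y; x∈p∧x∉q⇒x∈p─q; p─q⊆p; p⊆p∪q; q⊆p∪q; x∈p∪q⁻; x∈p∪q⁺;
         x∈p∩q⁺; x∈p∩q⁻; p∩q⊆p)
open import Data.List using (List; []; _∷_)
open import Data.List.Relation.Unary.All as All using (All; []; _∷_)
open import Data.Nat using (ℕ; zero; suc; _+_; _*_; _≤_; _<_; _≥_; z≤n; s≤s)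
open import Data.Nat.Properties
  using (≤-trans; ≤-reflexive; ≤-pred; m≤m+n; +-identityʳ; +-suc; +-monoˡ-≤;
         +-cancelˡ-≤; module ≤-Reasoning)
open import Data.Product using (∃-syntax; _×_; _,_; proj₁; proj₂; uncurry)
open import Data.Product.Properties using (≡-dec)
open import Data.Sum using (inj₁; inj₂; [_,_]′; reduce)
open import Data.Bool using (true; false; if_then_else_)
open import Data.Unit using (tt)
open import Data.Vec using ([]; _∷_; here; there; lookup)
open import Data.Vec.Properties using (lookup∘tabulate; lookup⇒[]=; []=⇒lookup)
open import Function using (_∘_)
open import Function.Bundles using (_⇔_; mk⇔; Equivalence)
open import Relation.Binary.PropositionalEquality
  using (_≡_; _≢_; refl; sym; trans; cong; cong₂; subst; module ≡-Reasoning)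
open import Relation.Nullary using (¬_; Dec; yes; no; does; contradiction)
open import Relation.Nullary.Decidable
  using (¬?; _×-dec_; _→-dec_; map′; dec-true; dec-false; decidable-stable)
open import Relation.Unary as U using (Pred; _≐_)

-- Cardinality of subsets of a finite set

x∈p─q⇒x∉q : ∀ {n} {p q : Subset n} {x} → x ∈ p ─ q → x ∉ q
x∈p─q⇒x∉q {p = _ ∷ p} {outside ∷ q} here      ()
x∈p─q⇒x∉q {p = _ ∷ p} {_ ∷ q}       (there i) (there j) = x∈p─q⇒x∉q i j

∪-nonempty : ∀ {n} {p q : Subset n} → Nonempty p → Nonempty (p ∪ q)
∪-nonempty {q = q} (x , x∈p) = x , p⊆p∪q q x∈p

∪-⊆ : ∀ {n} {p q r : Subset n} → p ⊆ r → q ⊆ r ─ p → p ∪ q ⊆ r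
∪-⊆ {p = p} {q} {r} p⊆r q⊆ = [ p⊆r , p─q⊆p r p ∘ q⊆ ]′ ∘ x∈p∪q⁻ p q

nonempty⇒0<∣p∣ : ∀ {n} {p : Subset n} → Nonempty p → 0 < ∣ p ∣
nonempty⇒0<∣p∣ {p = p} (x , x∈p) =
  ≤-trans (≤-reflexive (sym (∣⁅x⁆∣≡1 x)))
          (p⊆q⇒∣p∣≤∣q∣ λ i → subst (_∈ p) (sym (x∈⁅y⁆⇒x≡y x i)) x∈p)

0<∣p∣⇒nonempty : ∀ {n} {p : Subset n} → 0 < ∣ p ∣ → Nonempty p
0<∣p∣⇒nonempty {n} {p} 0<∣p∣ with nonempty? p
... | yes ne = ne
... | no ¬ne with () ←
  subst (0 <_) (trans (cong ∣_∣ (Empty-unique ¬ne)) (∣⊥∣≡0 n)) 0<∣p∣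

∣p∣≡1⇒unique : ∀ {n} {p : Subset n} {x y} → ∣ p ∣ ≡ 1 → x ∈ p → y ∈ p → x ≡ y
∣p∣≡1⇒unique {p = p} {x} {y} eq x∈p y∈p with x ≟ y
... | yes x≡y = x≡y
... | no x≢y with () ← ≤-trans
        (nonempty⇒0<∣p∣ (x , x∈p∧x≢y⇒x∈p-y x∈p x≢y))
        (≤-pred (subst (suc ∣ p - y ∣ ≤_) eq (x∈p⇒∣p-x∣<∣p∣ y∈p)))

∣p∪q∣+∣p∩q∣≡∣p∣+∣q∣ : ∀ {n} (p q : Subset n) →
                      ∣ p ∪ q ∣ + ∣ p ∩ q ∣ ≡ ∣ p ∣ + ∣ q ∣
∣p∪q∣+∣p∩q∣≡∣p∣+∣q∣ [] [] = refl
∣p∪q∣+∣p∩q∣≡∣p∣+∣q∣ (inside ∷ p) (inside ∷ q) = cong suc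
  (trans (+-suc _ _)
         (trans (cong suc (∣p∪q∣+∣p∩q∣≡∣p∣+∣q∣ p q)) (sym (+-suc _ _))))
∣p∪q∣+∣p∩q∣≡∣p∣+∣q∣ (inside ∷ p) (outside ∷ q) =
  cong suc (∣p∪q∣+∣p∩q∣≡∣p∣+∣q∣ p q)
∣p∪q∣+∣p∩q∣≡∣p∣+∣q∣ (outside ∷ p) (inside ∷ q) =
  trans (cong suc (∣p∪q∣+∣p∩q∣≡∣p∣+∣q∣ p q)) (sym (+-suc _ _))
∣p∪q∣+∣p∩q∣≡∣p∣+∣q∣ (outside ∷ p) (outside ∷ q) = ∣p∪q∣+∣p∩q∣≡∣p∣+∣q∣ p q

∣p∪q∣≤∣p∣+∣q∣ : ∀ {n} (p q : Subset n) → ∣ p ∪ q ∣ ≤ ∣ p ∣ + ∣ q ∣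
∣p∪q∣≤∣p∣+∣q∣ p q =
  ≤-trans (m≤m+n _ _) (≤-reflexive (∣p∪q∣+∣p∩q∣≡∣p∣+∣q∣ p q))

disjoint⇒∣p∪q∣≡∣p∣+∣q∣ : ∀ {n} (p q : Subset n) → Empty (p ∩ q) →
                         ∣ p ∪ q ∣ ≡ ∣ p ∣ + ∣ q ∣
disjoint⇒∣p∪q∣≡∣p∣+∣q∣ {n} p q disj = begin
  ∣ p ∪ q ∣              ≡⟨ +-identityʳ _ ⟨
  ∣ p ∪ q ∣ + 0          ≡⟨ cong (∣ p ∪ q ∣ +_) (∣⊥∣≡0 n) ⟨
  ∣ p ∪ q ∣ + ∣ ∅ {n} ∣  ≡⟨ cong (λ r → ∣ p ∪ q ∣ + ∣ r ∣) (Empty-unique disj) ⟨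
  ∣ p ∪ q ∣ + ∣ p ∩ q ∣  ≡⟨ ∣p∪q∣+∣p∩q∣≡∣p∣+∣q∣ p q ⟩
  ∣ p ∣ + ∣ q ∣          ∎
  where open ≡-Reasoning

injection⇒∣p∣≤∣q∣ : ∀ {a b} (p : Subset a) (q : Subset b) (f : Fin a → Fin b) →
                    (∀ {i} → i ∈ p → f i ∈ q) →
                    (∀ {i j} → i ∈ p → j ∈ p → f i ≡ f j → i ≡ j) →
                    ∣ p ∣ ≤ ∣ q ∣
injection⇒∣p∣≤∣q∣ []            q f into inj = z≤n
injection⇒∣p∣≤∣q∣ (outside ∷ p) q f into inj =
  injection⇒∣p∣≤∣q∣ p q (f ∘ suc) (into ∘ there)
    (λ i j eq → suc-injective (inj (there i) (there j) eq))
injection⇒∣p∣≤∣q∣ (inside ∷ p)  q f into inj = ≤-trans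
  (s≤s (injection⇒∣p∣≤∣q∣ p (q - f zero) (f ∘ suc)
    (λ i → x∈p∧x≢y⇒x∈p-y (into (there i))
             λ eq → contradiction (inj (there i) here eq) λ ())
    (λ i j eq → suc-injective (inj (there i) (there j) eq))))
  (x∈p⇒∣p-x∣<∣p∣ (into here))

module Hall {n : ℕ} (Γ : SimpleGraph n) (m : ℕ) where

  open SimpleGraph Γ using () renaming (sym to Edge-sym)
  open HallTheory Γ m

-- Membership in sets of points

  module _ {P : Pred Point 0ℓ} (P? : U.Decidable P) {x : Fin n} {y : Fin m} where

    lookup-comprehension :
      lookup (comprehension P?) (combine x y) ≡ does (P? (x , y))
    lookup-comprehension =
      trans (lookup∘tabulate _ (combine x y)) (cong (does ∘ P?) (remQuot-combine x y))

    ∈-comprehension⁺ : P (x , y) → (x , y) ∈ᴾ comprehension P?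
    ∈-comprehension⁺ p =
      lookup⇒[]= _ _ (trans lookup-comprehension (dec-true (P? _) p))

    ∈-comprehension⁻ : (x , y) ∈ᴾ comprehension P? → P (x , y)
    ∈-comprehension⁻ i
      with P? (x , y) | trans (sym lookup-comprehension) ([]=⇒lookup i)
    ... | yes p | _  = p
    ... | no _  | ()

  ∈-×Y⁺ : ∀ {V x y} → x ∈ V → (x , y) ∈ᴾ V ×Y
  ∈-×Y⁺ {V} = ∈-comprehension⁺ (λ a → proj₁ a ∈? V)

  ∈-×Y⁻ : ∀ {V x y} → (x , y) ∈ᴾ V ×Y → x ∈ V
  ∈-×Y⁻ {V} = ∈-comprehension⁻ (λ a → proj₁ a ∈? V)

  ∈-selectionGraph⁺ : ∀ {s x y} → y ≡ s x → (x , y) ∈ᴾ selectionGraph s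
  ∈-selectionGraph⁺ {s} = ∈-comprehension⁺ (λ a → proj₂ a ≟ s (proj₁ a))

  ∈-selectionGraph⁻ : ∀ {s x y} → (x , y) ∈ᴾ selectionGraph s → y ≡ s x
  ∈-selectionGraph⁻ {s} = ∈-comprehension⁻ (λ a → proj₂ a ≟ s (proj₁ a))

  ∈-compl⁺ : ∀ {A a} → (∀ b → b ∈ᴾ A → Disparate a b) → a ∈ᴾ compl A
  ∈-compl⁺ {A} f = ∈-comprehension⁺
    (λ a → everyPoint? λ b → (b ∈ᴾ? A) →-dec disparate? a b) λ x y → f (x , y)

  ∈-compl⁻ : ∀ {A a} → a ∈ᴾ compl A → ∀ b → b ∈ᴾ A → Disparate a b
  ∈-compl⁻ {A} i (x , y) = ∈-comprehension⁻
    (λ a → everyPoint? λ b → (b ∈ᴾ? A) →-dec disparate? a b) i x y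

  ∈-hull⁺ : ∀ {A a b} → b ∈ᴾ A → ¬ Disparate a b → a ∈ᴾ hull A
  ∈-hull⁺ {A} i ¬d = ∈-comprehension⁺
    (λ a → somePoint? λ b → (b ∈ᴾ? A) ×-dec ¬? (disparate? a b)) (_ , _ , i , ¬d)

  ∈-hull⁻ : ∀ {A a} → a ∈ᴾ hull A → ∃[ b ] (b ∈ᴾ A × ¬ Disparate a b)
  ∈-hull⁻ {A} i with x , y , p ← ∈-comprehension⁻
    (λ a → somePoint? λ b → (b ∈ᴾ? A) ×-dec ¬? (disparate? a b)) i = (x , y) , p

  ∉-compl⇒∈-hull : ∀ {A a} → ¬ (a ∈ᴾ compl A) → a ∈ᴾ hull A
  ∉-compl⇒∈-hull {A} {a} i∉ = decidable-stable (a ∈ᴾ? hull A) λ ¬hull →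
    i∉ (∈-compl⁺ λ b b∈A → decidable-stable (disparate? a b) (¬hull ∘ ∈-hull⁺ b∈A))

  ∈-⋃⁺ : ∀ {D H V a} → Nonempty V → V ⊆ D → a ∈ᴾ H V → a ∈ᴾ ⋃[ D ] H
  ∈-⋃⁺ {D} {H} {V} ne V⊆D i = ∈-comprehension⁺
    (λ a → anySubset? λ V → nonempty? V ×-dec (V ⊆? D) ×-dec (a ∈ᴾ? H V))
    (V , ne , V⊆D , i)

  ∈-⋃⁻ : ∀ {D H a} → a ∈ᴾ ⋃[ D ] H → ∃[ V ] (Nonempty V × V ⊆ D × a ∈ᴾ H V)
  ∈-⋃⁻ {D} {H} = ∈-comprehension⁻
    (λ a → anySubset? λ V → nonempty? V ×-dec (V ⊆? D) ×-dec (a ∈ᴾ? H V))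

  ∈-singleton⁻ : ∀ {a b} → b ∈ᴾ singleton a → b ≡ a
  ∈-singleton⁻ {x , y} {x′ , y′} i =
    uncurry (cong₂ _,_) (combine-injective x′ y′ x y (x∈⁅y⁆⇒x≡y _ i))

  -- Each element of Fin (n * m) codes a point, so inclusion of sets of points
  -- can be checked pointwise.
  ⊆-pointwise : ∀ {A B : PointSet} → (∀ a → a ∈ᴾ A → a ∈ᴾ B) → A ⊆ B
  ⊆-pointwise {A} {B} f {i} i∈A = subst (_∈ B) (combine-remQuot {n} m i)
    (f (remQuot m i) (subst (_∈ A) (sym (combine-remQuot {n} m i)) i∈A))

  Disparate-sym : ∀ {a b} → Disparate a b → Disparate b a
  Disparate-sym (a≢b , ¬e) = a≢b ∘ sym , λ eq → ¬e (sym eq) ∘ Edge-sym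

  ≢-vertex⇒≢ : ∀ {a b : Point} → proj₁ a ≢ proj₁ b → a ≢ b
  ≢-vertex⇒≢ x≢x′ = x≢x′ ∘ cong proj₁

  graph-vertex : ∀ {D} (F : Mapping D) {x y} → (x , y) ∈ᴾ graph F → x ∈ D
  graph-vertex F = ∈-×Y⁻ ∘ graph⊆ F

  ∈-remove↾⁺ : ∀ {D} (F : Mapping D) {a W x y} → (x , y) ∈ᴾ graph F →
               x ≢ proj₁ a → x ∈ W → Disparate (x , y) a →
               (x , y) ∈ᴾ graph (remove↾ F a W)
  ∈-remove↾⁺ F {a} {x = x} {y} b∈F x≢a x∈W disp = x∈p∩q⁺
    ( x∈p∩q⁺
        ( x∈p∩q⁺ (b∈F , ∈-×Y⁺ (x∈p∧x≢y⇒x∈p-y (graph-vertex F b∈F) x≢a))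
        , ∈-compl⁺ λ c c∈ → subst (Disparate (x , y)) (sym (∈-singleton⁻ c∈)) disp)
    , ∈-×Y⁺ x∈W)

  ∈-remove↾⁻ : ∀ {D} (F : Mapping D) {a W b} → b ∈ᴾ graph (remove↾ F a W) →
               b ∈ᴾ graph F × Disparate b a
  ∈-remove↾⁻ F {a} {W} i
    with i₁ , _ ← x∈p∩q⁻ _ (W ×Y) i
    with i₂ , c ← x∈p∩q⁻ _ (compl (singleton a)) i₁ =
    proj₁ (x∈p∩q⁻ (graph F) _ i₂) , ∈-compl⁻ c _ (x∈⁅x⁆ _)

-- Disparate selections on a subset of the vertices

  -- A disparate selection of a mapping on D, coded as a disparate set S of
  -- points of its graph with at least one point over each vertex of D.  Points
  -- over the same vertex are disparate when distinct, so S may have several of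
  -- them; any choice of one of them for each vertex is a disparate selection.
  Selects : ∀ {D} → Mapping D → PointSet → Set
  Selects {D} F S =
    S ⊆ graph F × DisparateSet S × (∀ x → x ∈ D → ∃[ y ] (x , y) ∈ᴾ S)

  Selectable : ∀ {D} → Mapping D → Set
  Selectable F = ∃[ S ] Selects F S

  disparateSet? : U.Decidable DisparateSet
  disparateSet? A = map′ (λ f (x , y) (x′ , y′) → f x y x′ y′)
                         (λ f x y x′ y′ → f (x , y) (x′ , y′))
    (everyPoint? λ a → everyPoint? λ b → (a ∈ᴾ? A) →-dec (b ∈ᴾ? A) →-dec
      ¬? (≡-dec _≟_ _≟_ a b) →-dec disparate? a b)

  selectable? : ∀ {D} (F : Mapping D) → Dec (Selectable F)
  selectable? {D} F = anySubset? λ S →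
    (S ⊆? graph F) ×-dec disparateSet? S ×-dec
    all? λ x → (x ∈? D) →-dec any? λ y → (x , y) ∈ᴾ? S

  selectable-empty : ∀ {D} (F : Mapping D) → Empty D → Selectable F
  selectable-empty F ¬D =
    ∅ , (λ i → contradiction i ∉⊥) , (λ _ _ i → contradiction i ∉⊥) ,
    λ x x∈D → contradiction (x , x∈D) ¬D

  selectable-if-nonempty : ∀ {D} (F : Mapping D) →
                           (Nonempty D → Selectable F) → Selectable F
  selectable-if-nonempty {D} F sel with nonempty? D
  ... | yes ne = sel ne
  ... | no ¬ne = selectable-empty F ¬ne

  -- A function with values in S on D that passes through a given point of S.
  choose : ∀ {D} (F : Mapping D) {S x y} → Selects F S → (x , y) ∈ᴾ S →
           ∃[ s ] ((∀ x′ → x′ ∈ D → (x′ , s x′) ∈ᴾ S) × s x ≡ y)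
  choose {D} F {S} {x} {y} (_ , _ , cover) i =
    proj₁ ∘ pick , proj₁ ∘ proj₂ ∘ pick , proj₂ (proj₂ (pick x)) refl
    where
    pick : ∀ x′ → ∃[ y′ ] ((x′ ∈ D → (x′ , y′) ∈ᴾ S) × (x′ ≡ x → y′ ≡ y))
    pick x′ with x′ ≟ x | x′ ∈? D
    ... | yes refl | _       = y , (λ _ → i) , λ _ → refl
    ... | no x′≢x  | yes x′∈ = proj₁ (cover x′ x′∈) ,
                               (λ _ → proj₂ (cover x′ x′∈)) ,
                               λ eq → contradiction eq x′≢x
    -- The value y outside D is arbitrary.
    ... | no x′≢x  | no x′∉  = y , (λ x′∈ → contradiction x′∈ x′∉) ,
                               λ eq → contradiction eq x′≢x

  -- Selections of F₁ on W and of F₂ on D ─ W glue to one of F if the graph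
  -- of F₂ is disparate from that of F₁.
  selectable-glue : ∀ {D W} (F : Mapping D) (F₁ : Mapping W) (F₂ : Mapping (D ─ W)) →
    graph F₁ ⊆ graph F → graph F₂ ⊆ graph F →
    (∀ a b → a ∈ᴾ graph F₁ → b ∈ᴾ graph F₂ → Disparate a b) →
    Selectable F₁ → Selectable F₂ → Selectable F
  selectable-glue {D} {W} F F₁ F₂ F₁⊆ F₂⊆ cross
                  (S , S⊆ , dS , cS) (T , T⊆ , dT , cT) =
    S ∪ T , [ F₁⊆ ∘ S⊆ , F₂⊆ ∘ T⊆ ]′ ∘ x∈p∪q⁻ S T , disp , cover
    where
    disp : DisparateSet (S ∪ T)
    disp a b i j a≢b with x∈p∪q⁻ S T i | x∈p∪q⁻ S T j
    ... | inj₁ a∈S | inj₁ b∈S = dS a b a∈S b∈S a≢b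
    ... | inj₁ a∈S | inj₂ b∈T = cross a b (S⊆ a∈S) (T⊆ b∈T)
    ... | inj₂ a∈T | inj₁ b∈S = Disparate-sym (cross b a (S⊆ b∈S) (T⊆ a∈T))
    ... | inj₂ a∈T | inj₂ b∈T = dT a b a∈T b∈T a≢b

    cover : ∀ x → x ∈ D → ∃[ y ] (x , y) ∈ᴾ (S ∪ T)
    cover x x∈D with x ∈? W
    ... | yes x∈W with y , i ← cS x x∈W = y , x∈p∪q⁺ (inj₁ i)
    ... | no x∉W with y , i ← cT x (x∈p∧x∉q⇒x∈p─q x∈D x∉W) = y , x∈p∪q⁺ (inj₂ i)

  -- A selection on D - x, disparate from a point over x, extends by it.
  selectable-extend : ∀ {D} (F : Mapping D) {x y} → (x , y) ∈ᴾ graph F →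
                      Selectable (remove↾ F (x , y) (D - x)) →
                      ∃[ S ] (Selects F S × (x , y) ∈ᴾ S)
  selectable-extend {D} F {x} {y} a∈F (S , S⊆ , dS , cS) =
    S ∪ singleton (x , y) , (sub , disp , cover) , x∈p∪q⁺ (inj₂ (x∈⁅x⁆ _))
    where
    sub : S ∪ singleton (x , y) ⊆ graph F
    sub = ⊆-pointwise λ b i →
      [ proj₁ ∘ ∈-remove↾⁻ F ∘ S⊆
      , (λ j → subst (_∈ᴾ graph F) (sym (∈-singleton⁻ j)) a∈F) ]′
      (x∈p∪q⁻ S _ i)

    disp : DisparateSet (S ∪ singleton (x , y))
    disp b c i j b≢c with x∈p∪q⁻ S _ i | x∈p∪q⁻ S _ j
    ... | inj₁ b∈S | inj₁ c∈S = dS b c b∈S c∈S b≢c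
    ... | inj₁ b∈S | inj₂ c∈ with refl ← ∈-singleton⁻ c∈ =
      proj₂ (∈-remove↾⁻ F (S⊆ b∈S))
    ... | inj₂ b∈ | inj₁ c∈S with refl ← ∈-singleton⁻ b∈ =
      Disparate-sym (proj₂ (∈-remove↾⁻ F (S⊆ c∈S)))
    ... | inj₂ b∈ | inj₂ c∈ =
      contradiction (trans (∈-singleton⁻ b∈) (sym (∈-singleton⁻ c∈))) b≢c

    cover : ∀ x′ → x′ ∈ D → ∃[ y′ ] (x′ , y′) ∈ᴾ (S ∪ singleton (x , y))
    cover x′ x′∈D with x′ ≟ x
    ... | yes refl = y , x∈p∪q⁺ (inj₂ (x∈⁅x⁆ _))
    ... | no x′≢x with y′ , i ← cS x′ (x∈p∧x≢y⇒x∈p-y x′∈D x′≢x) =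
      y′ , x∈p∪q⁺ (inj₁ i)

-- From a disparate selection to the generalized Hall condition

  -- s is disparate on D.
  DisparateOn : Subset n → (Fin n → Fin m) → Set
  DisparateOn D s = ∀ {x x′} → x ∈ D → x′ ∈ D → x ≢ x′ →
                    Disparate (x , s x) (x′ , s x′)

  -- The collection H over D is V ↦ G(s|V) on the nonempty V ⊆ D.
  Traces : (Fin n → Fin m) → Subset n → Collection → Set
  Traces s D H = ∀ V → Nonempty V → V ⊆ D → ∀ x y →
                 (x , y) ∈ᴾ H V ⇔ (x ∈ V × y ≡ s x)

  -- The collection V ↦ G(s|V).
  over : (Fin n → Fin m) → Collection
  over s V = comprehension λ a → (proj₁ a ∈? V) ×-dec (proj₂ a ≟ s (proj₁ a))

  ∈-over⁺ : ∀ {s V x y} → x ∈ V × y ≡ s x → (x , y) ∈ᴾ over s V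
  ∈-over⁺ {s} {V} =
    ∈-comprehension⁺ (λ a → (proj₁ a ∈? V) ×-dec (proj₂ a ≟ s (proj₁ a)))

  ∈-over⁻ : ∀ {s V x y} → (x , y) ∈ᴾ over s V → x ∈ V × y ≡ s x
  ∈-over⁻ {s} {V} =
    ∈-comprehension⁻ (λ a → (proj₁ a ∈? V) ×-dec (proj₂ a ≟ s (proj₁ a)))

  over-traces : ∀ {s D} → Traces s D (over s)
  over-traces {s} V _ _ x y = mk⇔ (∈-over⁻ {s} {V}) (∈-over⁺ {s} {V})

  traces-⊆ : ∀ {s D W H} → W ⊆ D → Traces s D H → Traces s W H
  traces-⊆ W⊆D tr V ne V⊆W = tr V ne (W⊆D ∘ V⊆W)

  module _ {s : Fin n → Fin m} {D W : Subset n} {H : Collection}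
           (disp : DisparateOn D s) (tr : Traces s D H)
           (neW : Nonempty W) (W⊆D : W ⊆ D) where

    -- The selection over D ─ W is disparate from the union of the members of
    -- the collection over W.
    traces-outside : ∀ {x b} → x ∈ D ─ W → b ∈ᴾ ⋃[ W ] H → Disparate (x , s x) b
    traces-outside {x} {x′ , y′} x∈ b∈
      with V , ne , V⊆W , b∈H ← ∈-⋃⁻ {W} {H} b∈
      with x′∈V , refl ← Equivalence.to (tr V ne (W⊆D ∘ V⊆W) x′ y′) b∈H =
      disp (p─q⊆p D W x∈) (W⊆D (V⊆W x′∈V))
        λ { refl → x∈p─q⇒x∉q {p = D} x∈ (V⊆W x′∈V) }

    traces-residual : Traces s (D ─ W) (residual H W)
    traces-residual V ne V⊆ x y = mk⇔ to from
      where
      trace = tr (W ∪ V) (∪-nonempty neW) (∪-⊆ W⊆D V⊆) x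

      to : (x , y) ∈ᴾ residual H W V → x ∈ V × y ≡ s x
      to i with i₁ , x∈V ← x∈p∩q⁻ _ (V ×Y) i =
        ∈-×Y⁻ x∈V , proj₂ (Equivalence.to (trace y) (proj₁ (x∈p∩q⁻ _ _ i₁)))

      from : x ∈ V × y ≡ s x → (x , y) ∈ᴾ residual H W V
      from (x∈V , refl) = x∈p∩q⁺
        ( x∈p∩q⁺ ( Equivalence.from (trace (s x)) (q⊆p∪q W V x∈V , refl)
                 , ∈-compl⁺ λ b → traces-outside (V⊆ x∈V))
        , ∈-×Y⁺ x∈V)

    -- The counted points lie over W, hence are at most as many as W has
    -- elements.
    traces-WDistributed : WDistributed D H W
    traces-WDistributed V ne V⊆ = injection⇒∣p∣≤∣q∣ A W vertex
      (λ {i} i∈A → proj₁ (point (coded i∈A)))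
      λ {i} {j} i∈A j∈A eq → trans (sym (combine-remQuot {n} m i))
        (trans (cong (uncurry combine)
                 (cong₂ _,_ eq (trans (proj₂ (point (coded i∈A)))
                   (trans (cong s eq) (sym (proj₂ (point (coded j∈A))))))))
               (combine-remQuot {n} m j))
      where
      A = H (W ∪ V) ∩ (W ×Y ∪ (hull (⋃[ W ] H) ∩ V ×Y))

      vertex : Fin (n * m) → Fin n
      vertex i = proj₁ (remQuot {n} m i)

      coded : ∀ {i} → i ∈ A → remQuot m i ∈ᴾ A
      coded {i} = subst (_∈ A) (sym (combine-remQuot {n} m i))

      point : ∀ {x y} → (x , y) ∈ᴾ A → x ∈ W × y ≡ s x
      point {x} {y} i
        with i₁ , i₂ ← x∈p∩q⁻ (H (W ∪ V)) _ i
        with _ , refl ← Equivalence.to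
               (tr (W ∪ V) (∪-nonempty neW) (∪-⊆ W⊆D V⊆) x y) i₁
        with x∈p∪q⁻ (W ×Y) _ i₂
      ... | inj₁ j = ∈-×Y⁻ j , refl
      ... | inj₂ j
        with h , k ← x∈p∩q⁻ _ (V ×Y) j
        with b , b∈ , ¬d ← ∈-hull⁻ {⋃[ W ] H} h =
        contradiction (traces-outside (V⊆ (∈-×Y⁻ k)) b∈) ¬d

  -- All that the distribution of the traces of s requires of the sets W_i.
  Proper : Stage → Set
  Proper t = Nonempty (Stage.set t) × Stage.set t ⊆ Stage.pre t

  DistributedAt : Stage → Set
  DistributedAt t = WDistributed (Stage.pre t) (Stage.coll t) (Stage.set t)

  stages-inside : ∀ {D W W′} (F : Mapping D) H Ws → W′ ⊆ W →
    stages F H (W ∷ W′ ∷ Ws) ≡ stage F H W ∷ stages (inner F H W) H (W′ ∷ Ws)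
  stages-inside {W = W} {W′} F H Ws W′⊆W =
    cong (stage F H W ∷_) (cong (if_then stages (inner F H W) H (W′ ∷ Ws)
      else stages (complementMapping F W (graph (inner F H W))) (residual H W)
                  (W′ ∷ Ws))
      (dec-true (W′ ⊆? W) W′⊆W))

  stages-outside : ∀ {D W W′} (F : Mapping D) H Ws → ¬ (W′ ⊆ W) →
    stages F H (W ∷ W′ ∷ Ws) ≡ stage F H W ∷
      stages (complementMapping F W (graph (inner F H W))) (residual H W) (W′ ∷ Ws)
  stages-outside {W = W} {W′} F H Ws W′⊈W =
    cong (stage F H W ∷_) (cong (if_then stages (inner F H W) H (W′ ∷ Ws)
      else stages (complementMapping F W (graph (inner F H W))) (residual H W)
                  (W′ ∷ Ws))
      (dec-false (W′ ⊆? W) W′⊈W))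

  traces-stages : ∀ {s D} (F : Mapping D) H W Ws →
                  DisparateOn D s → Traces s D H →
                  All Proper (stages F H (W ∷ Ws)) →
                  All DistributedAt (stages F H (W ∷ Ws))
  traces-stages {s} F H W [] disp tr ((ne , W⊆D) ∷ []) =
    traces-WDistributed {s} {H = H} disp tr ne W⊆D ∷ []
  traces-stages {s} {D} F H W (W′ ∷ Ws) disp tr ps = split (W′ ⊆? W)
    where
    neW : Nonempty W
    neW = proj₁ (All.head ps)

    W⊆D : W ⊆ D
    W⊆D = proj₂ (All.head ps)

    wd : DistributedAt (stage F H W)
    wd = traces-WDistributed {s} {H = H} disp tr neW W⊆D

    split : Dec (W′ ⊆ W) → All DistributedAt (stages F H (W ∷ W′ ∷ Ws))
    split (yes W′⊆W) = subst (All DistributedAt) (sym eq) (wd ∷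
      traces-stages {s} (inner F H W) H W′ Ws (λ i j → disp (W⊆D i) (W⊆D j))
        (traces-⊆ {s} {H = H} W⊆D tr) (All.tail (subst (All Proper) eq ps)))
      where eq = stages-inside F H Ws W′⊆W
    split (no W′⊈W) = subst (All DistributedAt) (sym eq) (wd ∷
      traces-stages {s} (complementMapping F W (graph (inner F H W))) (residual H W)
        W′ Ws (λ i j → disp (p─q⊆p D W i) (p─q⊆p D W j))
        (traces-residual {s} {H = H} disp tr neW W⊆D)
        (All.tail (subst (All Proper) eq ps)))
      where eq = stages-outside F H Ws W′⊈W

  ∣over∣ : ∀ s V → ∣ over s V ∣ ≥ ∣ V ∣
  ∣over∣ s V = injection⇒∣p∣≤∣q∣ V (over s V) (λ x → combine x (s x))
    (λ x∈V → ∈-over⁺ {s} {V} (x∈V , refl))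
    (λ {x} {x′} _ _ eq → proj₁ (combine-injective x (s x) x′ (s x′) eq))

  selectable⇒generalizedHall≤ : ∀ k {D} (F : Mapping D) → Nonempty D →
                                Selectable F → GeneralizedHall≤ (suc k) F
  selectable⇒generalizedHall≤ k {D} F (x₀ , x₀∈D) (S , sel@(S⊆ , dS , cover))
    with y₀ , a∈S ← cover x₀ x₀∈D
    with ∣ D ∣ | nonempty⇒0<∣p∣ (x₀ , x₀∈D)
  ... | suc zero    | _ = inj₁ (refl , _ , S⊆ a∈S)
  ... | suc (suc _) | _ with s , s∈S , _ ← choose F sel a∈S =
    inj₂ (s≤s (s≤s z≤n) , over s ,
      (collection , λ V ne V⊆D → disparate V⊆D , ∣over∣ s V) ,
      λ W Ws (_ , crit) → traces-stages F (over s) W Ws disp (over-traces {s} {D})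
        (All.map (λ ((ne , W⊆ , _) , _) → ne , λ {x} → W⊆ {x}) crit))
    where
    disp : DisparateOn D s
    disp i j x≢x′ = dS _ _ (s∈S _ i) (s∈S _ j) (≢-vertex⇒≢ x≢x′)

    collection : IsCollection F (over s)
    collection V ne V⊆D = ⊆-pointwise λ (x , y) i →
      let (x∈V , y≡) = ∈-over⁻ {s} {V} i in
      x∈p∩q⁺ ( subst (λ y → (x , y) ∈ᴾ graph F) (sym y≡) (S⊆ (s∈S x (V⊆D x∈V)))
             , ∈-×Y⁺ x∈V)

    disparate : ∀ {V} → V ⊆ D → DisparateSet (over s V)
    disparate {V} V⊆D (x , y) (x′ , y′) i j a≢b
      with x∈V , refl ← ∈-over⁻ {s} {V} i | x′∈V , refl ← ∈-over⁻ {s} {V} j =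
      disp (V⊆D x∈V) (V⊆D x′∈V) λ { refl → a≢b refl }

-- From the generalized Hall condition to a disparate selection

  -- The two mappings obtained from F and a Hall collection at a set W: one on
  -- W, with the restricted collection, and one on D ─ W, with the residual.
  module _ {D : Subset n} (F : Mapping D) (H : Collection) {W : Subset n}
           (neW : Nonempty W) (W⊆D : W ⊆ D)
           (hall : IsHallCollection F H) where

    private
      R : Collection
      R = residual H W

      F₁ : Mapping W
      F₁ = inner F H W

      F₂ : Mapping (D ─ W)
      F₂ = complementMapping F W (graph F₁)

    ∈-collection⁻ : ∀ {V a} → Nonempty V → V ⊆ D → a ∈ᴾ H V →
                    a ∈ᴾ graph F × proj₁ a ∈ V
    ∈-collection⁻ {V} ne V⊆D i
      with j , k ← x∈p∩q⁻ (graph F) (V ×Y) (proj₁ hall V ne V⊆D i) = j , ∈-×Y⁻ k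

    ∈-collection-∪⁻ : ∀ {V a} → V ⊆ D ─ W → a ∈ᴾ H (W ∪ V) →
                      a ∈ᴾ graph F × proj₁ a ∈ W ∪ V
    ∈-collection-∪⁻ V⊆ = ∈-collection⁻ (∪-nonempty neW) (∪-⊆ W⊆D V⊆)

    hall-∪ : ∀ {V} → V ⊆ D ─ W →
             DisparateSet (H (W ∪ V)) × ∣ H (W ∪ V) ∣ ≥ ∣ W ∪ V ∣
    hall-∪ {V} V⊆ = proj₂ hall (W ∪ V) (∪-nonempty neW) (∪-⊆ W⊆D V⊆)

    ∈-residual⁻ : ∀ {V a} → a ∈ᴾ R V →
                  a ∈ᴾ H (W ∪ V) × a ∈ᴾ compl (⋃[ W ] H) × proj₁ a ∈ V
    ∈-residual⁻ {V} i
      with j , k ← x∈p∩q⁻ _ (V ×Y) i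
      with j₁ , j₂ ← x∈p∩q⁻ (H (W ∪ V)) _ j = j₁ , j₂ , ∈-×Y⁻ k

    ∈-inner⁻ : ∀ {a} → a ∈ᴾ graph F₁ → a ∈ᴾ graph F × a ∈ᴾ compl (⋃[ D ─ W ] R)
    ∈-inner⁻ i =
      let (j , k) = x∈p∩q⁻ (graph (F ↾ W)) (compl (⋃[ D ─ W ] R)) i
      in proj₁ (x∈p∩q⁻ (graph F) (W ×Y) j) , k

    ∈-complementMapping⁻ : ∀ {a} → a ∈ᴾ graph F₂ →
                           a ∈ᴾ graph F × a ∈ᴾ compl (graph F₁)
    ∈-complementMapping⁻ i =
      let (j , k) = x∈p∩q⁻ (graph (F ↾ (D ─ W))) (compl (graph F₁)) i
      in proj₁ (x∈p∩q⁻ (graph F) ((D ─ W) ×Y) j) , k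

    inner-hall : IsHallCollection F₁ H
    inner-hall = collection , λ V ne V⊆W → proj₂ hall V ne (W⊆D ∘ V⊆W)
      where
      collection : IsCollection F₁ H
      collection V ne V⊆W = ⊆-pointwise λ a i →
        let (a∈F , x∈V) = ∈-collection⁻ ne (W⊆D ∘ V⊆W) i in
        x∈p∩q⁺
          ( x∈p∩q⁺
            ( x∈p∩q⁺ (a∈F , ∈-×Y⁺ (V⊆W x∈V))
            , ∈-compl⁺ λ b b∈ →
                let (_ , _ , _ , b∈R) = ∈-⋃⁻ {D ─ W} {R} b∈
                    (_ , b∈compl , _) = ∈-residual⁻ b∈R
                in Disparate-sym (∈-compl⁻ b∈compl a (∈-⋃⁺ {W} {H} ne V⊆W i)))
          , ∈-×Y⁺ x∈V)

    -- At most |W| points of A_{W ∪ V} are missing from the residual set, as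
    -- each of them is counted in the W-distribution.
    residual-hall : WDistributed D H W → IsHallCollection F₂ R
    residual-hall wd = collection , λ V ne V⊆ → disparate V⊆ , card V ne V⊆
      where
      collection : IsCollection F₂ R
      collection V ne V⊆ = ⊆-pointwise λ a i →
        let (a∈H , _ , x∈V) = ∈-residual⁻ i in
        x∈p∩q⁺
          ( x∈p∩q⁺
            ( x∈p∩q⁺ (proj₁ (∈-collection-∪⁻ V⊆ a∈H) , ∈-×Y⁺ (V⊆ x∈V))
            , ∈-compl⁺ λ b b∈ → Disparate-sym
                (∈-compl⁻ (proj₂ (∈-inner⁻ b∈)) a (∈-⋃⁺ {D ─ W} {R} ne V⊆ i)))
          , ∈-×Y⁺ x∈V)

      disparate : ∀ {V} → V ⊆ D ─ W → DisparateSet (R V)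
      disparate {V} V⊆ a b i j = proj₁ (hall-∪ V⊆) a b
        (proj₁ (∈-residual⁻ i)) (proj₁ (∈-residual⁻ j))

      card : ∀ V → Nonempty V → V ⊆ D ─ W → ∣ R V ∣ ≥ ∣ V ∣
      card V ne V⊆ = +-cancelˡ-≤ ∣ W ∣ _ _ (begin
        ∣ W ∣ + ∣ V ∣                ≡⟨ disjoint⇒∣p∪q∣≡∣p∣+∣q∣ W V disjoint ⟨
        ∣ W ∪ V ∣                    ≤⟨ proj₂ (hall-∪ V⊆) ⟩
        ∣ H (W ∪ V) ∣                ≤⟨ p⊆q⇒∣p∣≤∣q∣ (⊆-pointwise split) ⟩
        ∣ H (W ∪ V) ∩ B ∪ R V ∣      ≤⟨ ∣p∪q∣≤∣p∣+∣q∣ (H (W ∪ V) ∩ B) (R V) ⟩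
        ∣ H (W ∪ V) ∩ B ∣ + ∣ R V ∣  ≤⟨ +-monoˡ-≤ ∣ R V ∣ (wd V ne V⊆) ⟩
        ∣ W ∣ + ∣ R V ∣              ∎)
        where
        open ≤-Reasoning

        B : PointSet
        B = W ×Y ∪ (hull (⋃[ W ] H) ∩ V ×Y)

        disjoint : Empty (W ∩ V)
        disjoint (x , i) with x∈W , x∈V ← x∈p∩q⁻ W V i =
          x∈p─q⇒x∉q {p = D} (V⊆ x∈V) x∈W

        split : ∀ a → a ∈ᴾ H (W ∪ V) → a ∈ᴾ (H (W ∪ V) ∩ B ∪ R V)
        split a i with a ∈ᴾ? compl (⋃[ W ] H)
                     | x∈p∪q⁻ W V (proj₂ (∈-collection-∪⁻ V⊆ i))
        ... | _     | inj₁ x∈W = x∈p∪q⁺ (inj₁ (x∈p∩q⁺ (i , x∈p∪q⁺ (inj₁ (∈-×Y⁺ x∈W)))))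
        ... | yes c | inj₂ x∈V = x∈p∪q⁺ (inj₂ (x∈p∩q⁺ (x∈p∩q⁺ (i , c) , ∈-×Y⁺ x∈V)))
        ... | no ¬c | inj₂ x∈V = x∈p∪q⁺ (inj₁ (x∈p∩q⁺ (i , x∈p∪q⁺ (inj₂
                (x∈p∩q⁺ (∉-compl⇒∈-hull {⋃[ W ] H} ¬c , ∈-×Y⁺ x∈V))))))

    selectable-inner-complement : Selectable F₁ → Selectable F₂ → Selectable F
    selectable-inner-complement = selectable-glue F F₁ F₂
      (⊆-pointwise λ _ → proj₁ ∘ ∈-inner⁻)
      (⊆-pointwise λ _ → proj₁ ∘ ∈-complementMapping⁻)
      λ a b i j → Disparate-sym (∈-compl⁻ (proj₂ (∈-complementMapping⁻ j)) a i)

  stages-head : ∀ {Q : Stage → Set} {D} (F : Mapping D) H {W} Ws →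
                All Q (stages F H (W ∷ Ws)) → Q (stage F H W)
  stages-head F H []      (q ∷ _) = q
  stages-head F H (_ ∷ _) (q ∷ _) = q

  cascade-inside : ∀ {D W W′ Ws} → W ⊆ D →
                   IsCascade W (W′ ∷ Ws) → IsCascade D (W ∷ W′ ∷ Ws)
  cascade-inside {D} {W} {W′} W⊆D (start , rest)
    rewrite dec-true (W ⊆? D) W⊆D | dec-true (W′ ⊆? W) (reduce start) =
    inj₁ W⊆D , inj₁ (reduce start) , rest

  cascade-outside : ∀ {D W W′ Ws} → W ⊆ D → ¬ (W′ ⊆ W) →
                    IsCascade (D ─ W) (W′ ∷ Ws) → IsCascade D (W ∷ W′ ∷ Ws)
  cascade-outside {D} {W} {W′} W⊆D W′⊈W (start , rest)
    rewrite dec-true (W ⊆? D) W⊆D | dec-false (W′ ⊆? W) W′⊈W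
          | dec-true (W′ ⊆? (D ─ W)) (reduce start) =
    inj₁ W⊆D , inj₂ (reduce start) , rest

  -- The recursive step of the condition, for a predicate P that on nonempty
  -- vertex sets is decidable and implies the existence of a selection.
  module StepSelectable
    (P : ∀ {D} → Mapping D → Set)
    (P⇒selectable : ∀ {D} (F : Mapping D) → P F → Selectable F)
    (P? : ∀ {D} (F : Mapping D) → Nonempty D → Dec (P F))
    where

    open Step P

    CriticalAt : Stage → Set
    CriticalAt t = MinimalCritical (Stage.map t) (Stage.set t)

    critical? : ∀ {D} (F : Mapping D) W → Dec (Critical F W)
    critical? {D} F W with nonempty? W
    ... | no ¬ne = no (¬ne ∘ proj₁)
    ... | yes ne = map′ (ne ,_) proj₂
      ((W ⊆? D) ×-dec any? λ x → any? λ y →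
        (x ∈? (D ─ W)) ×-dec ¬? (P? (remove↾ F (x , y) W) ne))

    critical⇒minimalCritical : ∀ {D} (F : Mapping D) {W} → Acc _⊂_ W →
                               Critical F W → ∃[ W′ ] MinimalCritical F W′
    critical⇒minimalCritical F {W} (acc rec) crit
      with anySubset? (λ W′ → (W′ ⊂? W) ×-dec critical? F W′)
    ... | yes (W′ , W′⊂W , crit′) = critical⇒minimalCritical F (rec W′⊂W) crit′
    ... | no ¬smaller = W , crit , λ W′ W′⊂W crit′ → ¬smaller (W′ , W′⊂W , crit′)

    module _ {D} (F : Mapping D) (H : Collection) {W : Subset n}
             (min : MinimalCritical F W) (dist : Distributed F H) where

      private
        W⊆D : W ⊆ D
        W⊆D = proj₁ (proj₂ (proj₁ min))

      distributed⇒WDistributed : WDistributed D H W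
      distributed⇒WDistributed =
        All.head (dist W [] ((inj₁ W⊆D , tt) , min ∷ []))

      -- A cascade that starts inside W, and one that starts outside, become
      -- cascades of F by putting W in front.
      inner-distributed : Distributed (inner F H W) H
      inner-distributed W′ Ws (casc@(start , _) , crit) =
        All.tail (subst (All DistributedAt) eq
          (dist W (W′ ∷ Ws)
            (cascade-inside W⊆D casc ,
              subst (All CriticalAt) (sym eq) (min ∷ crit))))
        where eq = stages-inside F H Ws (reduce start)

      residual-distributed :
        Distributed (complementMapping F W (graph (inner F H W))) (residual H W)
      residual-distributed W′ Ws (casc@(start , _) , crit) =
        All.tail (subst (All DistributedAt) eq
          (dist W (W′ ∷ Ws)
            (cascade-outside W⊆D W′⊈W casc ,
              subst (All CriticalAt) (sym eq) (min ∷ crit))))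
        where
        -- W′ is nonempty, being critical, and disjoint from W.
        W′⊈W : ¬ (W′ ⊆ W)
        W′⊈W W′⊆W = x∈p─q⇒x∉q {p = D} (reduce start x∈W′) (W′⊆W x∈W′)
          where
          x∈W′ = proj₂ (proj₁ (proj₁ (stages-head {CriticalAt}
            (complementMapping F W (graph (inner F H W))) (residual H W) Ws crit)))

        eq = stages-outside F H Ws W′⊈W

    -- If there is no critical set, D - x is empty or not critical for a point
    -- (x , y) of H D, so that this point extends to a selection of F.
    distributed⇒selectable : ∀ {D} → Acc _⊂_ D → (F : Mapping D) (H : Collection) →
                             Nonempty D → IsHallCollection F H → Distributed F H →
                             Selectable F
    distributed⇒selectable {D} (acc rec) F H ne hall dist
      with anySubset? (critical? F)
    ... | yes (W , crit)
      with W , min@((neW@(w , w∈W) , W⊆D , x , _ , x∈ , _) , _) ←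
             critical⇒minimalCritical F (⊂-wellFounded W) crit =
      selectable-inner-complement F H neW W⊆D hall
        (distributed⇒selectable
          (rec (W⊆D , x , p─q⊆p D W x∈ , x∈p─q⇒x∉q {p = D} x∈))
          (inner F H W) H neW (inner-hall F H neW W⊆D hall)
          (inner-distributed F H min dist))
        (distributed⇒selectable
          (rec (p─q⊆p D W , w , W⊆D w∈W , λ i → x∈p─q⇒x∉q {p = D} i w∈W))
          (complementMapping F W (graph (inner F H W))) (residual H W) (x , x∈)
          (residual-hall F H neW W⊆D hall (distributed⇒WDistributed F H min dist))
          (residual-distributed F H min dist))
    ... | no ¬crit
      with i , i∈ ← 0<∣p∣⇒nonempty
             (≤-trans (nonempty⇒0<∣p∣ ne) (proj₂ (proj₂ hall D ne λ j → j)))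
      with x , y , refl ← combine-surjective {n} {m} i
      with a∈F , x∈D ← ∈-collection⁻ F H ne (λ j → j) hall ne (λ j → j) i∈ =
      let (S , sel , _) = selectable-extend F a∈F rest in S , sel
      where
      rest = selectable-if-nonempty (remove↾ F (x , y) (D - x)) λ ne′ →
        P⇒selectable _ (decidable-stable (P? _ ne′) λ ¬p →
          ¬crit (D - x , ne′ , p─q⊆p D ⁅ x ⁆ , x , y ,
            x∈p∧x∉q⇒x∈p─q x∈D (λ j → x∈p─q⇒x∉q {p = D} j (x∈⁅x⁆ x)) , ¬p))

  -- The bound k is irrelevant for this direction: if it is exhausted, every
  -- nonempty proper subset of D is critical (H D provides a point, so that Y is
  -- nonempty), and the argument above still applies.
  generalizedHall≤⇒selectable : ∀ k {D} (F : Mapping D) →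
                                GeneralizedHall≤ k F → Selectable F
  generalizedHall≤? : ∀ k {D} (F : Mapping D) → Nonempty D →
                      Dec (GeneralizedHall≤ k F)

  generalizedHall≤⇒selectable (suc k) {D} F (inj₁ (∣D∣≡1 , i , i∈F))
    with x , y , refl ← combine-surjective {n} {m} i
    with S , sel , _ ← selectable-extend F i∈F
      (selectable-empty (remove↾ F (x , y) (D - x)) λ (x′ , x′∈) →
        x∈p─q⇒x∉q {p = D} x′∈ (subst (_∈ ⁅ x ⁆)
          (∣p∣≡1⇒unique ∣D∣≡1 (graph-vertex F i∈F) (p─q⊆p D ⁅ x ⁆ x′∈)) (x∈⁅x⁆ x))) =
    S , sel
  generalizedHall≤⇒selectable (suc k) {D} F (inj₂ (1<∣D∣ , H , hall , dist)) =
    distributed⇒selectable (⊂-wellFounded D) F H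
      (0<∣p∣⇒nonempty (≤-trans (s≤s z≤n) 1<∣D∣)) hall dist
    where open StepSelectable (GeneralizedHall≤ k)
                 (generalizedHall≤⇒selectable k) (generalizedHall≤? k)

  generalizedHall≤? zero    F ne = no λ ()
  generalizedHall≤? (suc k) F ne =
    map′ (selectable⇒generalizedHall≤ k F ne)
         (generalizedHall≤⇒selectable (suc k) F) (selectable? F)

  generalizedHall⇒selectable : ∀ {D} (F : Mapping D) → GeneralizedHall F → Selectable F
  generalizedHall⇒selectable {D} = generalizedHall≤⇒selectable ∣ D ∣

  selectable⇒generalizedHall : ∀ {D} (F : Mapping D) → Nonempty D →
                               Selectable F → GeneralizedHall F
  selectable⇒generalizedHall {D} F ne sel with ∣ D ∣ | nonempty⇒0<∣p∣ ne
  ... | suc k | _ = selectable⇒generalizedHall≤ k F ne sel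

-- The disparate kernel along an execution

  selection-point : ∀ {F s} → IsDisparateSelection F s → ∀ x → kernel F (x , s x)
  selection-point sel x = proj₁ sel x , _ , sel , refl

  selects-through⇒kernel : ∀ (F : Mapping ⊤) {S a} → Selects F S → a ∈ᴾ S → kernel F a
  selects-through⇒kernel F {S} {x , y} sel@(S⊆ , dS , _) a∈S
    with s , s∈S , sx≡y ← choose F sel a∈S =
    S⊆ a∈S , s , ((λ x′ → S⊆ (s∈S x′ ∈⊤)) , disp) , sx≡y
    where
    disp : DisparateSet (selectionGraph s)
    disp (x₁ , _) (x₂ , _) i j a≢b
      with refl ← ∈-selectionGraph⁻ {s} i | refl ← ∈-selectionGraph⁻ {s} j =
      dS _ _ (s∈S x₁ ∈⊤) (s∈S x₂ ∈⊤) a≢b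

  kernel⇒¬elim : ∀ (F : Mapping ⊤) {W a} → Nonempty W → kernel F a → ¬ elim F W a
  kernel⇒¬elim F {W} {x , y} ne (_ , s , (s∈F , dG) , refl) (a∈ , ¬hall) =
    ¬hall (selectable⇒generalizedHall _ ne
      (selectionGraph s ∩ W ×Y , ⊆-pointwise sub , disp , cover))
    where
    x∉W : x ∉ W
    x∉W = x∈p─q⇒x∉q {p = ⊤} (∈-×Y⁻ (proj₂ (x∈p∩q⁻ (graph F) _ a∈)))

    sub : ∀ b → b ∈ᴾ (selectionGraph s ∩ W ×Y) → b ∈ᴾ graph (remove↾ F (x , s x) W)
    sub (x′ , y′) i
      with j , k ← x∈p∩q⁻ (selectionGraph s) (W ×Y) i
      with refl ← ∈-selectionGraph⁻ {s} j = ∈-remove↾⁺ F (s∈F x′) x′≢x (∈-×Y⁻ k)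
        (dG _ _ j (∈-selectionGraph⁺ {s} refl) (≢-vertex⇒≢ x′≢x))
      where
      x′≢x : x′ ≢ x
      x′≢x refl = x∉W (∈-×Y⁻ k)

    disp : DisparateSet (selectionGraph s ∩ W ×Y)
    disp b c i j = dG b c (p∩q⊆p _ _ i) (p∩q⊆p _ _ j)

    cover : ∀ x′ → x′ ∈ W → ∃[ y′ ] (x′ , y′) ∈ᴾ (selectionGraph s ∩ W ×Y)
    cover x′ x′∈W = s x′ , x∈p∩q⁺ (∈-selectionGraph⁺ {s} refl , ∈-×Y⁺ x′∈W)

  kernel-eliminates : ∀ {F F′ : Mapping ⊤} {W} → EliminationSet F W →
                      Eliminates F W F′ → kernel F ≐ kernel F′
  kernel-eliminates {F} {F′} (ne , _) (F′⊆ , ⊆F′) =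
    (λ k@(_ , s , sel , eq) →
      kept k , s , (kept ∘ selection-point {F} sel , proj₂ sel) , eq) ,
    (λ (a∈F′ , s , (s∈F′ , dG) , eq) →
      proj₁ (F′⊆ a∈F′) , s , (proj₁ ∘ F′⊆ ∘ s∈F′ , dG) , eq)
    where
    kept : ∀ {a} → kernel F a → a ∈ᴾ graph F′
    kept k = ⊆F′ (proj₁ k , kernel⇒¬elim F ne k)

  kernel-final : ∀ {F} (run : Execution F) → kernel F ≐ kernel (final run)
  kernel-final (stop₃ _)          = (λ k → k) , (λ k → k)
  kernel-final {F} (stop₅ W F′ el rem _) = kernel-eliminates {F} {F′} el rem
  kernel-final {F} (continue W F′ el rem _ run)
    with to , from ← kernel-eliminates {F} {F′} el rem
       | to′ , from′ ← kernel-final run =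
    (λ k → to′ (to k)) , (λ k → from (from′ k))

  no-elimination⇒kernel : ∀ (F : Mapping ⊤) → (∀ W → ¬ EliminationSet F W) →
                          ∀ {a} → a ∈ᴾ graph F → kernel F a
  no-elimination⇒kernel F ¬el {x , y} a∈F
    with S , sel , a∈S ← selectable-extend F a∈F
      (selectable-if-nonempty (remove↾ F (x , y) (⊤ - x)) λ ne →
        decidable-stable (selectable? (remove↾ F (x , y) (⊤ - x))) λ ¬sel →
          ¬el (⊤ - x) (ne , (x , y) , x∈p∩q⁺ (a∈F , ∈-×Y⁺ (x∈p∧x∉q⇒x∈p─q ∈⊤ λ i →
                                      x∈p─q⇒x∉q {p = ⊤} i (x∈⁅x⁆ x))) ,
                       ¬sel ∘ generalizedHall⇒selectable (remove↾ F (x , y) (⊤ - x)))) =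
    selects-through⇒kernel F sel a∈S

  kernel⇒admits : ∀ (F : Mapping ⊤) {a} → kernel F a → AdmitsDisparateSelection F
  kernel⇒admits F (_ , s , sel , _) = s , sel

  ¬emptyImage⇒nonempty : ∀ {F F′ : Mapping ⊤} → Nonempty (graph F) →
                         ¬ HasEmptyImage F′ → Nonempty (graph F′)
  ¬emptyImage⇒nonempty {F′ = F′} (i , _) ¬empty
    with any? (λ y → (proj₁ (remQuot {n} m i) , y) ∈ᴾ? graph F′)
  ... | yes (y , y∈) = _ , y∈
  ... | no ¬any = contradiction (_ , λ y y∈ → ¬any (y , y∈)) ¬empty

  stop₃⇒disparate : ∀ {F} → Nonempty (graph F) → (run : Execution F) →
                    StopsAtStep3 run → DisparateMapping (final run)
  stop₃⇒disparate {F} ne (stop₃ ¬el) _ = ne , proj₁ , no-elimination⇒kernel F ¬el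
  stop₃⇒disparate {F} ne (continue _ F′ _ _ ¬empty run) =
    stop₃⇒disparate (¬emptyImage⇒nonempty {F} {F′} ne ¬empty) run

  stop₅⇒emptyImage : ∀ {F} (run : Execution F) → StopsAtStep5 run →
                     HasEmptyImage (final run)
  stop₅⇒emptyImage (stop₅ _ _ _ _ empty)        _  = empty
  stop₅⇒emptyImage (continue _ _ _ _ _ run) s₅ = stop₅⇒emptyImage run s₅

  ¬stop₅⇔stop₃ : ∀ {F} (run : Execution F) → (¬ StopsAtStep5 run) ⇔ StopsAtStep3 run
  ¬stop₅⇔stop₃ (stop₃ _)                = mk⇔ (λ _ → tt) (λ _ ())
  ¬stop₅⇔stop₃ (stop₅ _ _ _ _ _)        = mk⇔ (λ ¬tt → ¬tt tt) (λ ())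
  ¬stop₅⇔stop₃ (continue _ _ _ _ _ run) = ¬stop₅⇔stop₃ run

  admits⇒¬emptyImage : ∀ {F} → AdmitsDisparateSelection F → ¬ HasEmptyImage F
  admits⇒¬emptyImage (s , s∈F , _) (x , empty) = empty (s x) (s∈F x)

  -- A disparate mapping has a point, and a selection through it.
  disparate⇒admits : ∀ {F} → DisparateMapping F → AdmitsDisparateSelection F
  disparate⇒admits {F} ((i , i∈F) , _ , F⊆)
    with x , y , refl ← combine-surjective {n} {m} i =
    kernel⇒admits F (F⊆ i∈F)

  module _ {F : Mapping ⊤} (neF : Nonempty (graph F)) (run : Execution F) where

    admits⇒¬stop₅ : AdmitsDisparateSelection F → ¬ StopsAtStep5 run
    admits⇒¬stop₅ (s , sel) s₅ with x , empty ← stop₅⇒emptyImage run s₅ =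
      empty (s x) (proj₁ (proj₁ (kernel-final run) (selection-point {F} sel x)))

    stop₃⇒admits : StopsAtStep3 run → AdmitsDisparateSelection F
    stop₃⇒admits s₃
      with (i , i∈) , _ , ⊆K ← stop₃⇒disparate neF run s₃
      with x , y , refl ← combine-surjective {n} {m} i =
      kernel⇒admits F (proj₂ (kernel-final run) (⊆K i∈))

    disparate⇒stop₃ : DisparateMapping (final run) → StopsAtStep3 run
    disparate⇒stop₃ d = Equivalence.to (¬stop₅⇔stop₃ run) λ s₅ →
      admits⇒¬emptyImage {final run} (disparate⇒admits {final run} d)
        (stop₅⇒emptyImage run s₅)

theorem10p4 : ∀ {n : ℕ} (Γ : SimpleGraph n) (m : ℕ) →
    let open HallTheory Γ m in
    (F : Mapping ⊤) → Nonempty (graph F) →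
    (run : Execution F) →
    (AdmitsDisparateSelection F ⇔ (¬ StopsAtStep5 run)) ×
    ((¬ StopsAtStep5 run) ⇔ StopsAtStep3 run) ×
    (StopsAtStep3 run ⇔ DisparateMapping (final run)) ×
    (DisparateMapping (final run) ⇔
    (Nonempty (graph (final run)) × (kernel F ≐ ⟦ graph (final run) ⟧)))
theorem10p4 Γ m F neF run =
    mk⇔ (admits⇒¬stop₅ neF run)
        (stop₃⇒admits neF run ∘ Equivalence.to (¬stop₅⇔stop₃ run))
  , ¬stop₅⇔stop₃ run
  , mk⇔ (stop₃⇒disparate neF run) (disparate⇒stop₃ neF run)
  , mk⇔ (λ (ne , K′⊆ , ⊆K′) → ne , (λ k → K′⊆ (to k)) , (λ i → from (⊆K′ i)))
        (λ (ne , K⊆ , ⊆K) → ne , (λ k → K⊆ (from k)) , (λ i → to (⊆K i)))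
  where
  open Hall Γ m
  to = proj₁ (kernel-final run)
  from = proj₂ (kernel-final run)
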